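{- If $G$ is a connected graph on $4$ or more vertices, then $G^4$ is $4$-ordered Hamiltonian.
   Context: All graphs are finite simple graphs. $d_G(v,w)$ denotes the distance in $G$ between vertices $v$ and $w$. For a positive integer $n$, the $n$-th power $G^n$ of a graph $G$ is the simple graph with the same vertex set as $G$ in which two distinct vertices $v,w$ are adjacent if and only if $d_G(v,w)\leq n$. A graph $G$ is $k$-ordered Hamiltonian if for any sequence $v_1,v_2,\dots,v_k$ of $k$ distinct vertices of $G$ there is a Hamiltonian cycle in $G$ containing these vertices in the given order, i.e. traversing the cycle from $v_1$ in one of its two directions, one meets $v_1,v_2,\dots,v_k$ in this order before returning to $v_1$. -}

module Defs where

open import Data.Fin.Base using (Fin)
open import Data.Fin.Properties using (_≟_; any?)
open import Data.List.Base using (List; []; _∷_; _++_; length; reverse; take)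
open import Data.List.Membership.Propositional using (_∈_)
open import Data.List.Relation.Binary.Sublist.Propositional using (_⊆_)
open import Data.List.Relation.Unary.Linked using (Linked)
open import Data.List.Relation.Unary.Unique.Propositional using (Unique)
open import Data.Nat.Base using (ℕ; zero; suc; _≤_; _<_; s≤s; s≤s⁻¹)
open import Data.Nat.Properties using (anyUpTo?; allUpTo?; ≮⇒≥; <⇒≱)
open import Data.Product.Base using (∃; ∃₂; _×_; _,_)
open import Data.Sum.Base using (_⊎_)
open import Data.Unit.Base using (⊤)
open import Data.Vec.Base using (Vec; toList)
open import Level using (0ℓ)
open import Relation.Binary.Core using (Rel)
open import Relation.Binary.Definitions using (Symmetric; Irreflexive; Decidable)
open import Relation.Binary.PropositionalEquality.Core using (_≡_; _≢_; refl; sym)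
open import Relation.Nullary.Decidable using (Dec; map′; _×-dec_; ¬?)

-- Adjacency is required to be decidable, as it is for every finite graph
-- in classical mathematics.

record Graph (n : ℕ) : Set₁ where
  field
    Adj        : Rel (Fin n) 0ℓ
    adj?       : Decidable Adj
    adj-sym    : Symmetric Adj
    adj-irrefl : Irreflexive _≡_ Adj

open Graph public

data Walk {n : ℕ} (G : Graph n) : ℕ → Rel (Fin n) 0ℓ where
  stop : ∀ {v} → Walk G zero v v
  step : ∀ {k u v w} → Adj G u v → Walk G k v w → Walk G (suc k) u w

Connected : ∀ {n} → Graph n → Set
Connected G = ∀ v w → ∃ λ k → Walk G k v w

-- "d_G(v,w) = d".  If v and w lie in different components, there is no such d
-- (the distance is infinite).

IsDistance : ∀ {n} → Graph n → Fin n → Fin n → ℕ → Set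
IsDistance G v w d = Walk G d v w × (∀ {m} → Walk G m v w → d ≤ m)

PowerAdj : ∀ {n} → Graph n → ℕ → Rel (Fin n) 0ℓ
PowerAdj G k v w = v ≢ w × ∃ λ d → IsDistance G v w d × d ≤ k

module _ {n : ℕ} (G : Graph n) where

  private
    snoc : ∀ {k u v w} → Walk G k u v → Adj G v w → Walk G (suc k) u w
    snoc stop       b = step b stop
    snoc (step a p) b = step a (snoc p b)

    walk-sym : ∀ {k} → Symmetric (Walk G k)
    walk-sym stop       = stop
    walk-sym (step a p) = snoc (walk-sym p) (adj-sym G a)

    walk? : ∀ k → Decidable (Walk G k)
    walk? zero    v w = map′ (λ { refl → stop }) (λ { stop → refl }) (v ≟ w)
    walk? (suc k) v w =
      map′ (λ { (_ , a , p) → step a p }) (λ { (step a p) → _ , a , p })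
           (any? λ u → adj? G v u ×-dec walk? k u w)

    isDistance? : ∀ v w d → Dec (IsDistance G v w d)
    isDistance? v w d =
      map′ (λ { (p , min) → p , λ {m} q → ≮⇒≥ (λ m<d → min m<d q) })
           (λ { (p , min) → p , λ {m} m<d q → <⇒≱ m<d (min q) })
           (walk? d v w ×-dec allUpTo? (λ m → ¬? (walk? m v w)) d)

    powerAdj? : ∀ k → Decidable (PowerAdj G k)
    powerAdj? k v w =
      ¬? (v ≟ w) ×-dec
      map′ (λ { (d , d<1+k , δ) → d , δ , s≤s⁻¹ d<1+k })
           (λ { (d , δ , d≤k) → d , s≤s d≤k , δ })
           (anyUpTo? (isDistance? v w) (suc k))

  power : ℕ → Graph n
  power k = record
    { Adj        = PowerAdj G k
    ; adj?       = powerAdj? k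
    ; adj-sym    = λ { (v≢w , d , (p , min) , d≤k) →
                       (λ w≡v → v≢w (sym w≡v)) ,
                       d , (walk-sym p , λ q → min (walk-sym q)) , d≤k }
    ; adj-irrefl = λ { v≡w (v≢w , _) → v≢w v≡w }
    }

-- A cycle is given by the list of its vertices, each occurring once, read from
-- some starting vertex in some direction.  Appending take 1 cs adds the closing
-- edge from the last vertex back to the first.

record IsHamiltonianCycle {n : ℕ} (G : Graph n) (cs : List (Fin n)) : Set where
  field
    length≥3 : 3 ≤ length cs
    distinct : Unique cs
    closed   : Linked (Adj G) (cs ++ take 1 cs)
    spanning : ∀ v → v ∈ cs

-- ts is one full turn around the cycle cs, from any starting vertex and in
-- either direction.

IsTraversal : ∀ {A : Set} → List A → List A → Set
IsTraversal cs ts =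
  ∃₂ λ xs ys → (cs ≡ xs ++ ys ⊎ reverse cs ≡ xs ++ ys) × ts ≡ ys ++ xs

-- _⊆_ is the order-preserving sublist relation.

MeetsInOrder : ∀ {A : Set} → List A → List A → Set
MeetsInOrder cs []       = ⊤
MeetsInOrder cs (v ∷ vs) = ∃ λ ts → IsTraversal cs (v ∷ ts) × vs ⊆ ts

OrderedHamiltonian : ∀ {n} → ℕ → Graph n → Set
OrderedHamiltonian {n} k G =
  (vs : Vec (Fin n) k) → Unique (toList vs) →
  ∃ λ cs → IsHamiltonianCycle G cs × MeetsInOrder cs (toList vs)

{-# OPTIONS --safe #-}

-- Work in a spanning tree and sweep it towards a root, covering the vertices
-- swept so far by disjoint paths of G⁴, each with two ends that remain to be
-- prolonged.  A subtree with one mark is covered by one path, whose ends are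
-- within 1 and 3 of the parent of its root; a subtree with two marks that are
-- opposite in the cyclic order by two paths, whose four ends are within 1, 2, 3
-- and 4 of that parent.  (Two marks that are neighbours in the cyclic order are
-- joined into one path as soon as they meet.)  The end at distance 4 absorbs the
-- parent, the one at distance 3 absorbs everything unmarked that hangs off it,
-- and after one step towards the root the ends are again within 1, 2, 3 and 4.
-- Two such quadruples of ends cannot always be matched, so the root is chosen at
-- a vertex all of whose branches carry at most one mark, with a single exception
-- carrying at most two.

module Submission where

open import Defs
import Algebra.Solver.CommutativeMonoid
open import Data.Bool.Base using (Bool; true; false)
import Data.Bool.Properties as Bool
open import Data.Fin.Base using (Fin; zero; suc; toℕ)
import Data.Fin.Properties as Fin
open import Data.List.Base
  using (List; []; _∷_; [_]; _++_; length; reverse; take; drop; map; filter; allFin)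
open import Data.List.Membership.Propositional using (_∈_)
open import Data.List.Membership.Propositional.Properties
  using (∈-++⁻; ∈-allFin; ∈-filter⁺; ∈-filter⁻)
open import Data.List.Membership.Propositional.Properties.WithK using (unique∧set⇒bag)
import Data.List.Properties as List
open import Data.List.Relation.Binary.BagAndSetEquality using (∼bag⇒↭)
open import Data.List.Relation.Binary.Permutation.Propositional
  using (_↭_; ↭-refl; ↭-reflexive; ↭-sym; ↭-trans; prep; swap; ↭⇒↭ₛ)
open import Data.List.Relation.Binary.Permutation.Propositional.Properties
  using (++⁺; ++⁺ʳ; ++⁺ˡ; shift; ∈-resp-↭; ↭-reverse; ++-commutativeMonoid; ↭-length; filter-↭)
import Data.List.Relation.Binary.Permutation.Setoid.Properties as Setoid↭
open import Data.List.Relation.Binary.Sublist.Propositional using (_⊆_; []; _∷ʳ_; _∷_; minimum)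
import Data.List.Relation.Binary.Sublist.Propositional.Properties as Sublist
import Data.List.Relation.Binary.Subset.Propositional as Subset
open import Data.List.Relation.Unary.All as All using (All; []; _∷_)
open import Data.List.Relation.Unary.All.Properties using (¬Any⇒All¬)
open import Data.List.Relation.Unary.AllPairs using ([]; _∷_)
open import Data.List.Relation.Unary.Any using (here; there)
open import Data.List.Relation.Unary.Linked using (Linked; [-]; _∷_)
open import Data.List.Relation.Unary.Unique.Propositional using (Unique)
open import Data.List.Relation.Unary.Unique.Propositional.Properties using (allFin⁺; filter⁺; map⁻)
open import Data.Nat.Base using (ℕ; zero; suc; _+_; _⊔_; _≤_; z≤n; s≤s; s≤s⁻¹)
open import Data.Nat.Induction using (<-rec)
import Data.Nat.Properties as ℕ
open import Data.Nat.Properties using (_≤?_; ≤-refl; ≤-trans; ≤-reflexive)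
open import Data.Nat.Tactic.RingSolver using (solve-∀)
open import Data.Product.Base using (∃; ∃₂; _×_; _,_; proj₂)
open import Data.Sum.Base using (_⊎_; inj₁; inj₂)
open import Data.Vec.Base using (Vec; []; _∷_; toList; lookup)
open import Data.Vec.Membership.Propositional.Properties using (∈-lookup; ∈-toList⁺; ∈-toList⁻)
import Data.Vec.Properties as Vec
open import Data.Vec.Relation.Unary.Any.Properties using (lookup-index)
open import Function.Base using (_∘_; case_of_)
open import Function.Bundles using (_⇔_; mk⇔)
open import Relation.Binary.PropositionalEquality
  using (_≡_; _≢_; refl; sym; trans; cong; cong₂; subst; setoid)
open import Relation.Nullary.Decidable
  using (Dec; yes; no; True; toWitness; from-yes; map′; _×-dec_; _⊎-dec_; _→-dec_)

-- Neighbours in the cyclic order of the four marks have different parity.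
parity : Fin 4 → Bool
parity zero                   = true
parity (suc zero)             = false
parity (suc (suc zero))       = true
parity (suc (suc (suc zero))) = false

Unique-resp-↭ : ∀ {A : Set} {xs ys : List A} → xs ↭ ys → Unique xs → Unique ys
Unique-resp-↭ π = Setoid↭.Unique-resp-↭ (setoid _) (↭⇒↭ₛ π)

Unique-resp-⊆ : ∀ {A : Set} {xs ys : List A} → xs ⊆ ys → Unique ys → Unique xs
Unique-resp-⊆ []         []       = []
Unique-resp-⊆ (_ ∷ʳ τ)   (_ ∷ u)  = Unique-resp-⊆ τ u
Unique-resp-⊆ (refl ∷ τ) (x∉ ∷ u) = Sublist.All-resp-⊆ τ x∉ ∷ Unique-resp-⊆ τ u

Unique-⇔⇒↭ : ∀ {A : Set} {xs ys : List A} → Unique xs → Unique ys →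
             (∀ {x} → x ∈ xs ⇔ x ∈ ys) → xs ↭ ys
Unique-⇔⇒↭ u u′ eq = ∼bag⇒↭ (unique∧set⇒bag u u′ eq)

open module ↭-Solver {A : Set} = Algebra.Solver.CommutativeMonoid (++-commutativeMonoid {A = A})
  using (solve; _⊕_; _⊜_)

-- Walks of bounded length, and paths in the fourth power.

module Nearness {n : ℕ} (G : Graph n) where

  Near : ℕ → Fin n → Fin n → Set
  Near r x y = ∃ λ k → k ≤ r × Walk G k x y

  Near-refl : ∀ {x} → Near 0 x x
  Near-refl = 0 , z≤n , stop

  walk-trans : ∀ {k m x y z} → Walk G k x y → Walk G m y z → Walk G (k + m) x z
  walk-trans stop       q = q
  walk-trans (step a p) q = step a (walk-trans p q)

  Near-trans : ∀ {r s x y z} → Near r x y → Near s y z → Near (r + s) x z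
  Near-trans (k , k≤r , p) (m , m≤s , q) = k + m , ℕ.+-mono-≤ k≤r m≤s , walk-trans p q

  Near-mono : ∀ {r s x y} → r ≤ s → Near r x y → Near s x y
  Near-mono r≤s (k , k≤r , p) = k , ≤-trans k≤r r≤s , p

  Near-edge : ∀ {x y} → Adj G x y → Near 1 x y
  Near-edge a = 1 , ≤-refl , step a stop

  Near-sym : ∀ {r x y} → Near r x y → Near r y x
  Near-sym (k , k≤r , p) = k , k≤r , subst (λ m → Walk G m _ _) (ℕ.+-identityʳ k) (rev p stop)
    where
    rev : ∀ {k m x y z} → Walk G k x y → Walk G m x z → Walk G (k + m) y z
    rev                             stop       q = q
    rev {suc k} {m} {y = y} {z = z} (step a p) q =
      subst (λ l → Walk G l y z) (ℕ.+-suc k m) (rev p (step (adj-sym G a) q))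

  -- A step may even stay in place; that the vertices differ follows only at the end, when they are
  -- known to be a permutation of all vertices.
  data Path : Fin n → Fin n → List (Fin n) → Set where
    stop : ∀ {x} → Path x x [ x ]
    _∷_  : ∀ {x y z l} → Near 4 x y → Path y z l → Path x z (x ∷ l)

  concat : ∀ {x y u z l m} → Path x y l → Near 4 y u → Path u z m → Path x z (l ++ m)
  concat stop    b q = b ∷ q
  concat (a ∷ p) b q = a ∷ concat p b q

  reversePath : ∀ {x y l} → Path x y l → Path y x (reverse l)
  reversePath stop = stop
  reversePath {l = x ∷ l} (a ∷ p) = subst (Path _ _) (sym (List.unfold-reverse x l))
    (concat (reversePath p) (Near-sym a) stop)

-- Spanning trees.

module SpanningTrees {n : ℕ} (G : Graph n) where
  open import Data.List.Membership.DecPropositional (Fin._≟_ {n}) using (_∈?_)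

  -- A tree with root v, one branch at a time: graft e c t hangs the root of c
  -- below the root v of t.
  data Tree (v : Fin n) : Set where
    leaf  : Tree v
    graft : ∀ {w} → Adj G v w → Tree w → Tree v → Tree v

  below : ∀ {v} → Tree v → List (Fin n)
  below leaf              = []
  below (graft {w} _ c t) = (w ∷ below c) ++ below t

  vertices : ∀ {v} → Tree v → List (Fin n)
  vertices {v} t = v ∷ below t

  addLeaf : ∀ {v u w} (t : Tree v) → u ∈ vertices t → Adj G u w →
            ∃ λ (t′ : Tree v) → below t′ ↭ w ∷ below t
  addLeaf t (here refl) e = graft e leaf t , ↭-refl
  addLeaf {w = w} (graft {x} e₁ c t) (there u∈) e with ∈-++⁻ (x ∷ below c) u∈
  ... | inj₁ u∈c with c′ , π ← addLeaf c u∈c e =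
        graft e₁ c′ t , ↭-trans (prep _ (++⁺ʳ (below t) π)) (swap _ w ↭-refl)
  ... | inj₂ u∈t with t′ , π ← addLeaf t (there u∈t) e =
        graft e₁ c t′ , ↭-trans (++⁺ˡ _ π) (shift w (x ∷ below c) (below t))

  -- The walk is followed edge by edge, and each vertex met outside the tree is hung as a leaf below
  -- its predecessor.
  reach : ∀ {v u x k} (t : Tree v) → Unique (vertices t) → u ∈ vertices t → Walk G k u x →
          ∃ λ (t′ : Tree v) → Unique (vertices t′) × vertices t Subset.⊆ vertices t′ × x ∈ vertices t′
  reach t distinct u∈ stop = t , distinct , (λ y∈ → y∈) , u∈
  reach {v} t distinct u∈ (step {v = w} e p) with w ∈? vertices t
  ... | yes w∈ = reach t distinct w∈ p
  ... | no  w∉ with t₁ , π ← addLeaf t u∈ e =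
    let π′ = ↭-trans (prep v π) (swap v w ↭-refl)
        t₂ , distinct′ , t₁⊆t₂ , x∈ = reach t₁
          (Unique-resp-↭ (↭-sym π′) (¬Any⇒All¬ _ w∉ ∷ distinct)) (∈-resp-↭ (↭-sym π′) (here refl)) p
    in t₂ , distinct′ , (λ y∈ → t₁⊆t₂ (∈-resp-↭ (↭-sym π′) (there y∈))) , x∈

  reachAll : Connected G → ∀ v xs →
             ∃ λ (t : Tree v) → Unique (vertices t) × All (_∈ vertices t) xs
  reachAll _         v []       = leaf , [] ∷ [] , []
  reachAll connected v (x ∷ xs) =
    let t , distinct , xs∈           = reachAll connected v xs
        t′ , distinct′ , t⊆t′ , x∈ = reach t distinct (here refl) (proj₂ (connected v x))
    in t′ , distinct′ , x∈ ∷ All.map t⊆t′ xs∈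

  spanningTree : Connected G → ∀ v → ∃ λ (t : Tree v) → vertices t ↭ allFin n
  spanningTree connected v with t , distinct , all∈ ← reachAll connected v (allFin n) =
    t , Unique-⇔⇒↭ distinct (allFin⁺ n)
          (λ {x} → mk⇔ (λ _ → ∈-allFin x) (λ _ → All.lookup all∈ (∈-allFin x)))

-- Strands and how they are joined.

module Strands {n : ℕ} (G : Graph n) (vs : Vec (Fin n) 4) where
  open Nearness G
  open SpanningTrees G

  -- A path in G⁴ whose vertices are us in some order, which passes the marks with
  -- indices is in that order and whose ends are within a and b of v in G.
  record Strand (v : Fin n) (is : List (Fin 4)) (a b : ℕ) (us : List (Fin n)) : Set where
    constructor strand
    field
      {source target} : Fin n
      {cells}         : List (Fin n)
      path            : Path source target cells
      source~         : Near a source v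
      target~         : Near b target v
      marks           : map (lookup vs) is ⊆ cells
      covers          : cells ↭ us

  private variable
    v w       : Fin n
    is js     : List (Fin 4)
    i j k l   : Fin 4
    a b a′ b′ : ℕ
    us ws xs  : List (Fin n)

  flip : Strand v is a b us → Strand v (reverse is) b a us
  flip {is = is} (strand p s t m c) = strand (reversePath p) t s
    (subst (_⊆ _) (sym (List.reverse-map (lookup vs) is)) (Sublist.reverse⁺ m))
    (↭-trans (↭-reverse _) c)

  infixl 5 _⟫_

  -- The two meeting ends are near the same `v`, hence at most `b + a′` apart. For numerals,
  -- evaluation settles the inequality.
  _⟫_ : Strand v is a b us → Strand v js a′ b′ ws → {True (b + a′ ≤? 4)} →
        Strand v (is ++ js) a b′ (us ++ ws)
  _⟫_ {is = is} {js = js} (strand p s t m c) (strand p′ s′ t′ m′ c′) {le} =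
    strand (concat p (Near-mono (toWitness le) (Near-trans t (Near-sym s′))) p′) s t′
      (subst (_⊆ _) (sym (List.map-++ (lookup vs) is js)) (Sublist.++⁺ m m′))
      (++⁺ c c′)

  widen : Strand v is a b us → {True (a ≤? a′)} → {True (b ≤? b′)} → Strand v is a′ b′ us
  widen (strand p s t m c) {α} {β} =
    strand p (Near-mono (toWitness α) s) (Near-mono (toWitness β) t) m c

  reindex : us ↭ ws → Strand v is a b us → Strand v is a b ws
  reindex π (strand p s t m c) = strand p s t m (↭-trans c π)

  move : Adj G w v → Strand w is a b us → Strand v is (suc a) (suc b) us
  move {a = a} {b = b} e (strand p s t m c) = strand p (far s) (far t) m c
    where
    far : ∀ {r x} → Near r x _ → Near (suc r) x _
    far {r} q = Near-mono (≤-reflexive (ℕ.+-comm r 1)) (Near-trans q (Near-edge e))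

  point : Strand v [] 0 0 [ v ]
  point = strand stop Near-refl Near-refl (minimum _) ↭-refl

  markedPoint : lookup vs i ≡ v → Strand v [ i ] 0 0 [ v ]
  markedPoint refl = strand stop Near-refl Near-refl (refl ∷ []) ↭-refl

  -- What hangs off v without having been assigned to a strand with marks.
  data Rest (v : Fin n) : List (Fin n) → Set where
    none : Rest v []
    some : Strand v [] 1 2 us → Rest v us

  -- The near end of the rest, at distance 1, meets an end at distance at most 3, and its far end,
  -- at distance 2, takes over. The maximum `2 ⊔ b` also covers an empty rest.
  append : Strand v is a b us → Rest v ws → {True (b ≤? 3)} → Strand v is a (2 ⊔ b) (us ++ ws)
  append {b = b} {us = us} (strand p s t m c) none =
    strand p s (Near-mono (ℕ.m≤n⊔m 2 b) t) m
      (↭-trans c (↭-reflexive (sym (List.++-identityʳ us))))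
  append {b = b} (strand p s t m c) (some (strand p′ s′ t′ m′ c′)) {le} =
    strand (concat p (Near-mono (ℕ.+-monoˡ-≤ 1 (toWitness le)) (Near-trans t (Near-sym s′))) p′)
      s (Near-mono (ℕ.m≤m⊔n 2 b) t′)
      (subst (_⊆ _) (List.++-identityʳ _) (Sublist.++⁺ m (minimum _)))
      (++⁺ c c′)

  -- Up to symmetry, the ways in which two strands share the distances 1, 2, 3, 4:
  -- Slots x y z says that these are x, 4 for one strand and y, z for the other.
  data Slots : ℕ → ℕ → ℕ → Set where
    14∣23 : Slots 1 2 3
    24∣13 : Slots 2 1 3
    34∣12 : Slots 3 1 2

  data Pair (v : Fin n) (us : List (Fin n)) : Set where
    joined : parity i ≢ parity j → Strand v (i ∷ j ∷ []) 1 3 us → Pair v us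
    apart  : ∀ {x y z} → parity i ≡ parity j → Slots x y z →
             Strand v [ i ] x 4 ws → Strand v [ j ] y z xs → ws ++ xs ↭ us → Pair v us

  -- A whole branch at v, including its root, with k marks.
  data Child (v : Fin n) : ℕ → List (Fin n) → Set where
    blob   : Strand v [] 1 2 us → Child v 0 us
    single : Strand v [ i ] 1 3 us → Child v 1 us
    pair   : Pair v us → Child v 2 us

  -- In Core and State, us are the vertices of some branches at v, without v
  -- itself: v is left free to prolong the strand that needs it most.
  data Core (v : Fin n) : ℕ → List (Fin n) → Set where
    none   : Core v 0 []
    single : Strand v [ i ] 1 3 us → Core v 1 us
    pair   : Pair v us → Core v 2 us
    triple : Pair v us → Strand v [ i ] 1 3 ws → Core v 3 (us ++ ws)
    quad   : Pair v us → Strand v [ i ] 1 3 ws → Strand v [ j ] 1 3 xs →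
             Core v 4 ((us ++ ws) ++ xs)

  data State (v : Fin n) (k : ℕ) (us : List (Fin n)) : Set where
    state : Core v k ws → Rest v xs → ws ++ xs ↭ us → State v k us

  data Tag (w : Fin n) : ℕ → Set where
    marked   : lookup vs i ≡ w → Tag w 1
    unmarked : Tag w 0

  -- Collecting branches at a vertex.

  addSingle : ∀ {m} → m ≤ 3 → Core v m us → Strand v [ i ] 1 3 ws → Core v (suc m) (us ++ ws)
  addSingle _ none s = single s
  addSingle {i = j} _ (single {i = i} s) t with parity i Bool.≟ parity j
  -- Opposite marks: the ends 1, 3 and 1, 3 are relaxed to 1, 4 and 2, 3, which fits `Slots`.
  ... | yes i≡j = pair (apart i≡j 14∣23 (widen s) (widen t) ↭-refl)
  ... | no  i≢j = pair (joined i≢j (s ⟫ t))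
  addSingle _ (pair p)     s = triple p s
  addSingle _ (triple p s) t = quad p s t
  addSingle (s≤s (s≤s (s≤s ()))) (quad _ _ _) _

  -- The disjunction keeps a pair from being added to a state that already contains one, the only
  -- combination that could fail.
  add : ∀ {m m′} → m′ + m ≤ 4 → m′ ≤ 1 ⊎ m ≤ 1 →
        State v m us → Child v m′ ws → State v (m′ + m) (us ++ ws)
  add _ _ (state {ws = xs} c none π) (blob s) =
    state c (some s) (++⁺ʳ _ (↭-trans (↭-reflexive (sym (List.++-identityʳ xs))) π))
  add {ws = ws} _ _ (state {ws = xs} {xs = ys} c (some r) π) (blob s) =
    state c (some (r ⟫ s))
      (↭-trans (solve 3 (λ x y w → x ⊕ (y ⊕ w) ⊜ (x ⊕ y) ⊕ w) ↭-refl xs ys ws) (++⁺ʳ ws π))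
  add {ws = ws} 1+m≤4 _ (state {ws = xs} {xs = ys} c r π) (single s) =
    state (addSingle (s≤s⁻¹ 1+m≤4) c s) r
      (↭-trans (solve 3 (λ x y w → (x ⊕ w) ⊕ y ⊜ (x ⊕ y) ⊕ w) ↭-refl xs ys ws) (++⁺ʳ ws π))
  add {ws = ws} _ _ (state {xs = ys} none r π) (pair p) =
    state (pair p) r
      (↭-trans (solve 2 (λ y w → w ⊕ y ⊜ y ⊕ w) ↭-refl ys ws) (++⁺ʳ ws π))
  add {ws = ws} _ _ (state {ws = xs} {xs = ys} (single s) r π) (pair p) =
    state (triple p s) r
      (↭-trans (solve 3 (λ x y w → (w ⊕ x) ⊕ y ⊜ (x ⊕ y) ⊕ w) ↭-refl xs ys ws) (++⁺ʳ ws π))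
  add _ (inj₁ (s≤s ())) _ (pair _)
  add _ (inj₂ (s≤s ())) (state (pair _) _ _) (pair _)
  add _ (inj₂ (s≤s ())) (state (triple _ _) _ _) (pair _)
  add _ (inj₂ (s≤s ())) (state (quad _ _ _) _ _) (pair _)

  -- Passing from a vertex to its parent.

  insert : ∀ xs → xs ++ ws ↭ us → (xs ++ [ v ]) ++ ws ↭ v ∷ us
  insert {ws = ws} {v = v} xs π =
    ↭-trans (solve 3 (λ x v w → (x ⊕ v) ⊕ w ⊜ v ⊕ (x ⊕ w)) ↭-refl xs [ v ] ws) (prep v π)

  closeBlob : Rest v us → Strand v [] 0 1 (v ∷ us)
  closeBlob none     = widen point
  closeBlob (some s) = point ⟫ flip s

  close : ∀ {t m} → Adj G w v → Tag w t → t + m ≤ 2 → State w m us → Child v (t + m) (w ∷ us)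
  close {w} e unmarked _ (state none r π) = blob (move e (reindex (prep w π) (closeBlob r)))
  close {w} e (marked q) _ (state none r π) =
    single (move e (reindex (prep w π) (append (markedPoint q) r)))
  close e unmarked _ (state {ws = xs} (single s) r π) =
    single (move e (reindex (insert xs π) (append (flip (s ⟫ point)) r)))
  close {w} e (marked {i = j} q) _ (state {ws = xs} {xs = ys} (single {i = i} s) r π)
    with parity i Bool.≟ parity j
  -- The mark at `w` opens a strand consisting of `w` alone. Both its ends are within 1 of `v`; one
  -- is relaxed to 3 to complement 2, 4.
  ... | yes i≡j = pair (apart i≡j 24∣13 (move e (append s r)) (widen (move e (markedPoint q))) π′)
    where
    π′ = ↭-trans (solve 3 (λ x w y → (x ⊕ y) ⊕ w ⊜ w ⊕ (x ⊕ y)) ↭-refl xs [ w ] ys) (prep w π)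
  ... | no  i≢j = pair (joined (i≢j ∘ sym)
        (move e (reindex (insert xs π) (append (flip (s ⟫ markedPoint q)) r))))
  close e unmarked _ (state {ws = xs} (pair (joined i≢j s)) r π) =
    pair (joined (i≢j ∘ sym) (move e (reindex (insert xs π) (append (flip (s ⟫ point)) r))))
  close {w} e unmarked _ (state {xs = ys} (pair (apart {ws = ps} {xs = qs} i≡j σ s t ρ)) r π) =
    pair (rearrange σ s t)
    where
    π₁ = ↭-trans (solve 4 (λ p q w y → (q ⊕ y) ⊕ (p ⊕ w) ⊜ w ⊕ ((p ⊕ q) ⊕ y)) ↭-refl ps qs [ w ] ys)
           (prep w (↭-trans (++⁺ʳ ys ρ) π))
    π₂ = ↭-trans (solve 4 (λ p q w y → ((p ⊕ w) ⊕ y) ⊕ q ⊜ w ⊕ ((p ⊕ q) ⊕ y)) ↭-refl ps qs [ w ] ys)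
           (prep w (↭-trans (++⁺ʳ ys ρ) π))
    -- Absorbing `w` turns the ends 1, 2, 3, 4 into 0, 1, 2, 3, and `move` restores them. This
    -- exchanges `14∣23` with `34∣12` and preserves `24∣13`. The rest `r` always goes to the end at
    -- distance 3, which in the last case lies on the strand that has absorbed `w`.
    rearrange : ∀ {x y z} → Slots x y z → Strand w _ x 4 ps → Strand w _ y z qs → Pair _ _
    rearrange 14∣23 s t = apart (sym i≡j) 34∣12 (move e (append t r)) (move e (flip (s ⟫ point))) π₁
    rearrange 24∣13 s t = apart (sym i≡j) 24∣13 (move e (append t r)) (move e (flip (s ⟫ point))) π₁
    rearrange 34∣12 s t = apart i≡j 14∣23 (move e (append (flip (s ⟫ point)) r)) (move e t) π₂
  close _ (marked _) (s≤s (s≤s ())) (state (pair _) _ _)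
  close _ unmarked   (s≤s (s≤s ())) (state (triple _ _) _ _)
  close _ (marked _) (s≤s (s≤s ())) (state (triple _ _) _ _)
  close _ unmarked   (s≤s (s≤s ())) (state (quad _ _ _) _ _)
  close _ (marked _) (s≤s (s≤s ())) (state (quad _ _ _) _ _)

  -- Closing up at the root.

  -- The right cyclic order up to rotation and reflection, once the indices are
  -- known to be distinct.
  data Alternating : List (Fin 4) → Set where
    even : parity i ≡ parity k → Alternating (i ∷ j ∷ k ∷ l ∷ [])
    odd  : parity j ≡ parity l → Alternating (i ∷ j ∷ k ∷ l ∷ [])

  data Closable (us : List (Fin n)) : Set where
    closable : Alternating is → Strand v is a b us → {True (a + b ≤? 4)} → Closable us

  two-of-three : ∀ {x y z : Bool} → x ≢ y → y ≢ z → x ≡ z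
  two-of-three x≢y y≢z = trans (Bool.¬-not x≢y) (sym (Bool.¬-not (y≢z ∘ sym)))

  finish : ∀ {t m} → Tag v t → t + m ≡ 4 → State v m us → Closable (v ∷ us)
  finish {v} unmarked refl (state {xs = rs}
      (quad {us = ds} {i = k} {ws = as} {xs = bs} (joined {i = i} {j = j} i≢j s) x y) r π)
    with parity j Bool.≟ parity k
  -- The neighbours `i` and `j` are already joined. If `k` is a neighbour of `j` it comes next;
  -- otherwise it is opposite to `j`, and `y` goes between them.
  ... | no  j≢k = closable (even (two-of-three i≢j j≢k)) (reindex π′ (append (s ⟫ point) r ⟫ x ⟫ y))
    where
    π′ = ↭-trans (solve 5 (λ d a b r v → (((d ⊕ v) ⊕ r) ⊕ a) ⊕ b ⊜ v ⊕ (((d ⊕ a) ⊕ b) ⊕ r))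
           ↭-refl ds as bs rs [ v ]) (prep v π)
  ... | yes j≡k = closable (odd j≡k) (reindex π′ (append (s ⟫ point) r ⟫ y ⟫ x))
    where
    π′ = ↭-trans (solve 5 (λ d a b r v → (((d ⊕ v) ⊕ r) ⊕ b) ⊕ a ⊜ v ⊕ (((d ⊕ a) ⊕ b) ⊕ r))
           ↭-refl ds as bs rs [ v ]) (prep v π)
  finish {v} unmarked refl (state {xs = rs}
      (quad {ws = as} {xs = bs} (apart {ws = ps} {xs = qs} i≡j σ s t ρ) x y) r π) = arrange σ s t
    where
    π₀ = prep v (↭-trans (++⁺ʳ rs (++⁺ʳ bs (++⁺ʳ as ρ))) π)
    π₁ = ↭-trans (solve 6 (λ p q a b r v →
           (((p ⊕ v) ⊕ a) ⊕ (q ⊕ r)) ⊕ b ⊜ v ⊕ ((((p ⊕ q) ⊕ a) ⊕ b) ⊕ r))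
           ↭-refl ps qs as bs rs [ v ]) π₀
    π₂ = ↭-trans (solve 6 (λ p q a b r v →
           ((((p ⊕ v) ⊕ r) ⊕ a) ⊕ q) ⊕ b ⊜ v ⊕ ((((p ⊕ q) ⊕ a) ⊕ b) ⊕ r))
           ↭-refl ps qs as bs rs [ v ]) π₀
    -- The opposite marks `i` and `j` are separated by those of `x` and `y`, in the order `i`, `x`,
    -- `j`, `y`. The end at distance 4 absorbs `v` and the one at 3 takes `r`; the flips keep every
    -- sum of meeting ends, the closing one included, at most 4.
    arrange : ∀ {x y z} → Slots x y z → Strand v _ x 4 ps → Strand v _ y z qs → Closable _
    arrange 14∣23 s t = closable (even i≡j)
      (reindex π₁ (s ⟫ point ⟫ flip x ⟫ flip (append t r) ⟫ y))
    arrange 24∣13 s t = closable (even i≡j)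
      (reindex π₁ (s ⟫ point ⟫ flip x ⟫ flip (append t r) ⟫ flip y))
    arrange 34∣12 s t = closable (even i≡j)
      (reindex π₂ (flip (append (flip (s ⟫ point)) r) ⟫ flip x ⟫ flip t ⟫ flip y))
  finish {v} (marked q) refl (state {xs = rs}
      (triple {us = ds} {i = k} {ws = as} (joined {i = i} {j = j} i≢j s) x) r π)
    with parity j Bool.≟ parity k
  ... | no  j≢k = closable (even (two-of-three i≢j j≢k))
                    (reindex π′ (append (s ⟫ x ⟫ markedPoint q) r))
    where
    π′ = ↭-trans (solve 4 (λ d a r v → ((d ⊕ a) ⊕ v) ⊕ r ⊜ v ⊕ ((d ⊕ a) ⊕ r))
           ↭-refl ds as rs [ v ]) (prep v π)
  ... | yes j≡k = closable (odd j≡k) (reindex π′ (append (s ⟫ markedPoint q) r ⟫ x))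
    where
    π′ = ↭-trans (solve 4 (λ d a r v → ((d ⊕ v) ⊕ r) ⊕ a ⊜ v ⊕ ((d ⊕ a) ⊕ r))
           ↭-refl ds as rs [ v ]) (prep v π)
  finish {v} (marked q) refl (state {xs = rs}
      (triple {ws = as} (apart {ws = ps} {xs = qs} i≡j σ s t ρ) x) r π) = arrange σ s t
    where
    π₀ = prep v (↭-trans (++⁺ʳ rs (++⁺ʳ as ρ)) π)
    π₁ = ↭-trans (solve 5 (λ p q a r v →
           (((p ⊕ v) ⊕ r) ⊕ q) ⊕ a ⊜ v ⊕ (((p ⊕ q) ⊕ a) ⊕ r)) ↭-refl ps qs as rs [ v ]) π₀
    π₂ = ↭-trans (solve 5 (λ p q a r v →
           ((p ⊕ v) ⊕ (q ⊕ r)) ⊕ a ⊜ v ⊕ (((p ⊕ q) ⊕ a) ⊕ r)) ↭-refl ps qs as rs [ v ]) π₀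
    -- Here `v` itself is the mark that separates `i` from `j` on one side.
    arrange : ∀ {x y z} → Slots x y z → Strand v _ x 4 ps → Strand v _ y z qs → Closable _
    arrange 14∣23 s t = closable (even i≡j) (reindex π₁ (append (s ⟫ markedPoint q) r ⟫ t ⟫ x))
    arrange 24∣13 s t = closable (even i≡j)
      (reindex π₂ (s ⟫ markedPoint q ⟫ flip (append t r) ⟫ flip x))
    arrange 34∣12 s t = closable (even i≡j)
      (reindex π₁ (append (s ⟫ markedPoint q) r ⟫ flip t ⟫ flip x))

  -- Counting marks and choosing the root.

  abstract
    mark? : ∀ w → Dec (∃ λ i → lookup vs i ≡ w)
    mark? w = Fin.any? λ i → lookup vs i Fin.≟ w

  infix 8 #_

  count : List (Fin n) → ℕ
  count us = length (filter mark? us)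

  tag : ∀ w → Tag w (count [ w ])
  tag w with mark? w
  ... | yes (_ , q) = marked q
  ... | no  _       = unmarked

  count-++ : ∀ us ws → count (us ++ ws) ≡ count us + count ws
  count-++ us ws = trans (cong length (List.filter-++ mark? us ws)) (List.length-++ (filter mark? us))

  count-all : Unique (toList vs) → count (allFin n) ≡ 4
  count-all distinct = trans (↭-length (Unique-⇔⇒↭ (filter⁺ mark? (allFin⁺ n)) distinct (mk⇔ to from)))
                         (Vec.length-toList vs)
    where
    to : ∀ {x} → x ∈ filter mark? (allFin n) → x ∈ toList vs
    to x∈ with _ , i , refl ← ∈-filter⁻ mark? {xs = allFin n} x∈ = ∈-toList⁺ (∈-lookup i vs)
    from : ∀ {x} → x ∈ toList vs → x ∈ filter mark? (allFin n)
    from x∈ = ∈-filter⁺ mark? (∈-allFin _) (_ , sym (lookup-index (∈-toList⁻ x∈)))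

  -- A structural form of `count (below t)`, split by branches as the sweep meets them.
  #_ : Tree v → ℕ
  # leaf              = 0
  # (graft {w} _ c t) = (count [ w ] + # c) + # t

  count-below : (t : Tree v) → count (below t) ≡ # t
  count-below leaf              = refl
  count-below (graft {w} _ c t) = trans (count-++ (w ∷ below c) (below t))
    (cong₂ _+_ (trans (count-++ [ w ] (below c)) (cong (count [ w ] +_) (count-below c))) (count-below t))

  transport : ∀ {m m′} → m ≡ m′ → us ↭ ws → State v m us → State v m′ ws
  transport refl ρ (state c r π) = state c r (↭-trans π ρ)

  transportClosable : us ↭ ws → Closable us → Closable ws
  transportClosable ρ (closable alt s {le}) = closable alt (reindex ρ s) {le}

  mutual
    branch : Adj G v w → (c : Tree w) → count [ w ] + # c ≤ 2 →
             Child v (count [ w ] + # c) (w ∷ below c)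
    branch {w = w} e c le = close (adj-sym G e) (tag w) le
      (absorb c (ℕ.m+n≤o⇒n≤o (count [ w ]) le) (state none none ↭-refl))

    -- With at most two marks in total, two pairs never meet, so the side condition of `add` holds.
    absorb : ∀ {m} (t : Tree v) → m + # t ≤ 2 → State v m us → State v (m + # t) (us ++ below t)
    absorb {us = us} {m} leaf _ s =
      transport (sym (ℕ.+-identityʳ m)) (↭-reflexive (sym (List.++-identityʳ us))) s
    absorb {us = us} {m} (graft {w} e c t) le s =
      transport eq (↭-reflexive (List.++-assoc us (w ∷ below c) (below t)))
        (absorb t le′
          (add (≤-trans (ℕ.m+n≤o⇒m≤o _ le′) (s≤s (s≤s z≤n))) (small {m} le) s
            (branch e c (ℕ.m+n≤o⇒m≤o _ (ℕ.m+n≤o⇒n≤o m le)))))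
      where
      regroup : ∀ m k l → (k + m) + l ≡ m + (k + l)
      regroup = solve-∀
      eq : ((count [ w ] + # c) + m) + # t ≡ m + ((count [ w ] + # c) + # t)
      eq = regroup m (count [ w ] + # c) (# t)
      le′ : ((count [ w ] + # c) + m) + # t ≤ 2
      le′ = ≤-trans (≤-reflexive eq) le
      small : ∀ {m k l} → m + (k + l) ≤ 2 → k ≤ 1 ⊎ m ≤ 1
      small {zero}        _                  = inj₂ z≤n
      small {suc zero}    _                  = inj₂ (s≤s z≤n)
      small {suc (suc m)} (s≤s (s≤s le))     =
        inj₁ (≤-trans (ℕ.m+n≤o⇒m≤o _ (ℕ.m+n≤o⇒n≤o m le)) z≤n)

  -- When a branch carries two or more marks, its root becomes the new root: the
  -- rest of the tree is then a branch of it, with at most two marks.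
  search : ∀ {m} (t : Tree v) → count [ v ] + (m + # t) ≡ 4 → State v m us →
           Closable (v ∷ us ++ below t)
  search {v} {us} {m} leaf eq s =
    transportClosable (prep v (↭-reflexive (sym (List.++-identityʳ us))))
      (finish (tag v) (trans (cong (count [ v ] +_) (sym (ℕ.+-identityʳ m))) eq) s)
  search {v} {us} {m} (graft {w} e c t) eq s with count [ w ] + # c ≤? 1
  ... | yes k≤1 = transportClosable (prep v (↭-reflexive (List.++-assoc us (w ∷ below c) (below t))))
    (search t (trans (shuffle (count [ v ]) m (count [ w ] + # c) (# t)) eq)
      (add (≤-trans (bound (count [ v ]) m (count [ w ] + # c) (# t)) (≤-reflexive eq)) (inj₁ k≤1)
        s (branch e c (≤-trans k≤1 (s≤s z≤n)))))
    where
    shuffle : ∀ a m k l → a + ((k + m) + l) ≡ a + (m + (k + l))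
    shuffle = solve-∀
    bound : ∀ a m k l → k + m ≤ a + (m + (k + l))
    bound a m k l = ≤-trans (ℕ.m≤m+n (k + m) l)
      (≤-trans (ℕ.m≤n+m _ a) (≤-reflexive (shuffle a m k l)))
  ... | no k≰1 = transportClosable
    (solve 5 (λ v u w c t → w ⊕ ((v ⊕ (u ⊕ t)) ⊕ c) ⊜ v ⊕ (u ⊕ ((w ⊕ c) ⊕ t)))
      ↭-refl [ v ] us [ w ] (below c) (below t))
    (search c (trans (shuffle (count [ v ]) m (count [ w ]) (# c) (# t)) eq)
      -- The old part enters first, when nothing has been collected at `w`, so it may carry two
      -- marks; any later branch carries at most one or moves the root again.
      (add (≤-trans (≤-reflexive (ℕ.+-identityʳ _)) (≤-trans upper≤2 (s≤s (s≤s z≤n)))) (inj₂ z≤n)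
        (state none none ↭-refl)
        (close e (tag v) upper≤2 (absorb t (ℕ.m+n≤o⇒n≤o (count [ v ]) upper≤2) s))))
    where
    shuffle : ∀ a m b k l → b + (((a + (m + l)) + 0) + k) ≡ a + (m + ((b + k) + l))
    shuffle = solve-∀
    regroup : ∀ a m k l → (a + (m + l)) + k ≡ a + (m + (k + l))
    regroup = solve-∀
    upper≤2 : count [ v ] + (m + # t) ≤ 2
    upper≤2 = ℕ.+-cancelʳ-≤ 2 _ 2 (≤-trans (ℕ.+-monoʳ-≤ _ (ℕ.≰⇒> k≰1))
      (≤-reflexive (trans (regroup (count [ v ]) m (count [ w ] + # c) (# t)) eq)))

-- From a path in the fourth power to a cycle.

module Cycles {n : ℕ} (G : Graph n) where
  open Nearness G

  walk? : ∀ k x y → Dec (Walk G k x y)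
  walk? zero    x y = map′ (λ { refl → stop }) (λ { stop → refl }) (x Fin.≟ y)
  walk? (suc k) x y = map′ (λ { (_ , e , p) → step e p }) (λ { (step e p) → _ , e , p })
    (Fin.any? λ z → adj? G x z ×-dec walk? k z y)

  -- `PowerAdj` asks for an exact distance where `Near` gives only some short walk. As the existence
  -- of shorter walks is decidable, strong induction descends to a minimal one.
  shortest : ∀ {x y} k → Walk G k x y → ∃ λ d → IsDistance G x y d × d ≤ k
  shortest {x} {y} = <-rec (λ k → Walk G k x y → _) λ k rec p →
    case ℕ.anyUpTo? (λ m → walk? m x y) k of λ where
      (yes (m , m<k , q)) → let d , δ , d≤m = rec m<k q in d , δ , ≤-trans d≤m (ℕ.<⇒≤ m<k)
      (no  ∄shorter)      → k , (p , λ {_} q → ℕ.≮⇒≥ λ m<k → ∄shorter (_ , m<k , q)) , ≤-refl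

  Near⇒PowerAdj : ∀ {r x y} → x ≢ y → Near r x y → PowerAdj G r x y
  Near⇒PowerAdj x≢y (k , k≤r , p) with d , δ , d≤k ← shortest k p =
    x≢y , d , δ , ≤-trans d≤k k≤r

  linked : ∀ {x y z l} → Path x y l → Unique l → All (_≢ z) l → Near 4 y z →
           Linked (PowerAdj G 4) (l ++ [ z ])
  linked stop            _               (x≢z ∷ _) b = Near⇒PowerAdj x≢z b ∷ [-]
  linked (a ∷ stop)      ((x≢y ∷ _) ∷ u) (_ ∷ ≢z)  b = Near⇒PowerAdj x≢y a ∷ linked stop u ≢z b
  linked (a ∷ p@(_ ∷ _)) ((x≢y ∷ _) ∷ u) (_ ∷ ≢z)  b = Near⇒PowerAdj x≢y a ∷ linked p u ≢z b

  -- The first edge is split off because the closing vertex `x` lies in `l`; the tail avoids it, as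
  -- `linked` requires.
  linkedCycle : ∀ {x y l} → Path x y l → Unique l → 2 ≤ length l → Near 4 y x →
                Linked (PowerAdj G 4) (l ++ take 1 l)
  linkedCycle stop            _                  (s≤s ())
  linkedCycle (a ∷ stop)      (x≢@(x≢y ∷ _) ∷ u) _ b =
    Near⇒PowerAdj x≢y a ∷ linked stop u (All.map (_∘ sym) x≢) b
  linkedCycle (a ∷ p@(_ ∷ _)) (x≢@(x≢y ∷ _) ∷ u) _ b =
    Near⇒PowerAdj x≢y a ∷ linked p u (All.map (_∘ sym) x≢) b

-- The cyclic order of the marks.

Turn : List (Fin 4) → Set
Turn is = ∃ λ (m : Fin 4) → drop (toℕ m) is ++ take (toℕ m) is ≡ allFin 4

abstract
  -- If one opposite pair of distinct indices has equal parity, the other two indices share the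
  -- other parity; so 0 faces 2 and 1 faces 3. All quadruples are checked by evaluation.
  alternating⇒turn : ∀ i j k l → let is = i ∷ j ∷ k ∷ l ∷ [] in
    Unique is → parity i ≡ parity k ⊎ parity j ≡ parity l →
    Turn is ⊎ Turn (reverse is)
  alternating⇒turn = from-yes
    (Fin.all? λ i → Fin.all? λ j → Fin.all? λ k → Fin.all? λ l →
      unique? (i ∷ j ∷ k ∷ l ∷ []) →-dec
      (parity i Bool.≟ parity k ⊎-dec parity j Bool.≟ parity l) →-dec
      (turn? (i ∷ j ∷ k ∷ l ∷ []) ⊎-dec turn? (reverse (i ∷ j ∷ k ∷ l ∷ []))))
    where
    open import Data.List.Relation.Unary.Unique.DecPropositional (Fin._≟_ {4}) using (unique?)
    turn? : ∀ is → Dec (Turn is)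
    turn? is = Fin.any? λ m → List.≡-dec Fin._≟_ (drop (toℕ m) is ++ take (toℕ m) is) (allFin 4)

⊆-split : ∀ {A : Set} (xs : List A) {y ys zs} → xs ++ y ∷ ys ⊆ zs →
          ∃₂ λ as bs → zs ≡ as ++ y ∷ bs × xs ⊆ as × ys ⊆ bs
⊆-split []       (refl ∷ τ) = [] , _ , refl , [] , τ
⊆-split []       (z ∷ʳ τ)   with as , bs , refl , σ , ρ ← ⊆-split [] τ =
  z ∷ as , bs , refl , z ∷ʳ σ , ρ
⊆-split (x ∷ xs) (z ∷ʳ τ)   with as , bs , refl , σ , ρ ← ⊆-split (x ∷ xs) τ =
  z ∷ as , bs , refl , z ∷ʳ σ , ρ
⊆-split (x ∷ xs) (refl ∷ τ) with as , bs , refl , σ , ρ ← ⊆-split xs τ =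
  x ∷ as , bs , refl , refl ∷ σ , ρ

-- Cutting `zs` just before the occurrence of `y` used by the sublist lifts the rotation from the
-- sublist to `zs`.
⊆-rotate : ∀ {A : Set} m {xs ys zs : List A} {y} → drop m xs ++ take m xs ≡ y ∷ ys → xs ⊆ zs →
           ∃₂ λ as bs → zs ≡ as ++ bs × ∃ λ ts → y ∷ ts ≡ bs ++ as × ys ⊆ ts
⊆-rotate m {xs} eq τ with drop m xs | take m xs | List.take++drop≡id m xs
-- The rotation is trivial, with `y` the first entry of the sublist.
⊆-rotate m refl τ | []     | x ∷ as | refl
  with cs , ds , refl , σ , ρ ← ⊆-split [] τ =
  cs , _ , refl , _ , refl , Sublist.++⁺ʳ cs (subst (_⊆ ds) (List.++-identityʳ as) ρ)
⊆-rotate m refl τ | b ∷ bs | as     | refl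
  with cs , ds , refl , σ , ρ ← ⊆-split as τ = cs , _ , refl , _ , refl , Sublist.++⁺ ρ σ

turn-⊆ : ∀ {A : Set} (f : Fin 4 → A) {is us} → Turn is → map f is ⊆ us →
         ∃₂ λ as bs → us ≡ as ++ bs × ∃ λ ts → f zero ∷ ts ≡ bs ++ as ×
           map f (drop 1 (allFin 4)) ⊆ ts
turn-⊆ f {is} (m , eq) = ⊆-rotate (toℕ m) (trans (sym map-turn) (cong (map f) eq))
  where
  map-turn : map f (drop (toℕ m) is ++ take (toℕ m) is) ≡
             drop (toℕ m) (map f is) ++ take (toℕ m) (map f is)
  map-turn = trans (List.map-++ f (drop (toℕ m) is) (take (toℕ m) is))
    (cong₂ _++_ (sym (List.drop-map (toℕ m) is)) (sym (List.take-map (toℕ m) is)))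

meetsInOrder : ∀ {A : Set} (vs : Vec A 4) {i j k l us} → let is = i ∷ j ∷ k ∷ l ∷ [] in
  Unique is → parity i ≡ parity k ⊎ parity j ≡ parity l → map (lookup vs) is ⊆ us →
  MeetsInOrder us (toList vs)
meetsInOrder vs@(_ ∷ _ ∷ _ ∷ _ ∷ []) {i} {j} {k} {l} distinct alternating τ
  with alternating⇒turn i j k l distinct alternating
... | inj₁ turn with as , bs , us≡ , ts , ts≡ , σ ← turn-⊆ (lookup vs) turn τ =
  ts , (as , bs , inj₁ us≡ , ts≡) , σ
... | inj₂ turn
  with as , bs , us≡ , ts , ts≡ , σ ← turn-⊆ (lookup vs) turn (Sublist.reverse⁺ τ) =
  ts , (as , bs , inj₂ us≡ , ts≡) , σ

-- Assembly.

closable⇒hamiltonian : ∀ {n} (G : Graph n) (vs : Vec (Fin n) 4) → 4 ≤ n →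
  Strands.Closable G vs (allFin n) →
  ∃ λ cs → IsHamiltonianCycle (power G 4) cs × MeetsInOrder cs (toList vs)
closable⇒hamiltonian {n} G vs 4≤n
  (Strands.closable {a = a} {b = b} alternating (Strands.strand {cells = cs} path s t marks covers) {a+b≤4}) =
  cs , record
    { length≥3 = ≤-trans (s≤s (s≤s (s≤s z≤n))) 4≤length
    ; distinct = distinct
    ; closed   = linkedCycle path distinct (≤-trans (s≤s (s≤s z≤n)) 4≤length)
                   (Near-mono (≤-trans (≤-reflexive (ℕ.+-comm b a)) (toWitness a+b≤4))
                     (Near-trans t (Near-sym s)))
    ; spanning = λ v → ∈-resp-↭ (↭-sym covers) (∈-allFin v)
    } , inOrder alternating marks
  where
  open Nearness G
  open Strands G vs
  open Cycles G
  distinct : Unique cs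
  distinct = Unique-resp-↭ (↭-sym covers) (allFin⁺ n)
  4≤length : 4 ≤ length cs
  4≤length = ≤-trans 4≤n (≤-reflexive (sym (trans (↭-length covers) (List.length-tabulate (λ i → i)))))
  inOrder : ∀ {is} → Alternating is → map (lookup vs) is ⊆ cs → MeetsInOrder cs (toList vs)
  -- Strands do not record that their indices are distinct; this is recovered from `cs` having no
  -- repetition.
  inOrder (even p) τ = meetsInOrder vs (map⁻ (Unique-resp-⊆ τ distinct)) (inj₁ p) τ
  inOrder (odd p)  τ = meetsInOrder vs (map⁻ (Unique-resp-⊆ τ distinct)) (inj₂ p) τ

theorem5p1 : (n : ℕ) → 4 ≤ n → (G : Graph n) → Connected G → OrderedHamiltonian 4 (power G 4)
theorem5p1 n 4≤n G connected vs distinct =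
  let open SpanningTrees G
      open Strands G vs
      -- Any vertex can serve as the first root, since `search` moves it; a mark is at hand.
      root     = lookup vs zero
      t , t↭all = spanningTree connected root
      four-marks : count [ root ] + # t ≡ 4
      four-marks = trans (cong (count [ root ] +_) (sym (count-below t)))
        (trans (sym (count-++ [ root ] (below t)))
          (trans (↭-length (filter-↭ mark? t↭all)) (count-all distinct)))
  in closable⇒hamiltonian G vs 4≤n
       (transportClosable t↭all (search t four-marks (state none none ↭-refl)))
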